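{- The longest $(9/4)$-free word over the ternary alphabet $\{0,1,2\}$ whose curling-number transform is overlap-free has length $84$. That is, there exists a $(9/4)$-free ternary word $x$ of length $84$ with $C(x)$ overlap-free, and there is no such word of length greater than $84$.
   Context: Words are indexed from $0$: a finite word of length $n$ is $x = x[0]x[1]\cdots x[n-1]$, and $x[i..j]$ denotes the factor (contiguous block) $x[i]\cdots x[j]$. A finite word $x$ of length $n \ge 1$ has period $p$, $1\le p\le n$, if $x[i]=x[i+p]$ for all $0\le i<n-p$; its exponent is $n/p$ where $p$ is its least period. A word is $\alpha$-free if it has no nonempty finite factor of exponent at least $\alpha$. An overlap is a word of the form $a x a x a$ with $a$ a single letter and $x$ a possibly empty word; a word is overlap-free if it contains no overlap as a factor (equivalently, it has no factor of exponent strictly greater than $2$). The curling number of a nonempty finite word $u$ is the largest integer $k \ge 1$ such that $u = y z^k$ for some (possibly empty) word $y$ and some nonempty word $z$. For a finite or infinite word $x$, the curling-number transform $C(x)$ is the word over the positive integers, of the same length as $x$, whose $i$-th letter $C(x)[i]$ is the curling number of the prefix $x[0..i]$. -}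

module Defs where

open import Data.Fin.Base using (Fin; toℕ)
open import Data.Integer.Base using (+_)
open import Data.List.Base
  using (List; []; _∷_; _++_; length; lookup; take; replicate; concat; tabulate)
open import Data.List.Properties using (≡-dec; length-++; ++-identityʳ)
open import Data.List.Relation.Binary.Infix.Heterogeneous using (Infix)
open import Data.Nat.Base using (ℕ; zero; suc; _+_; _≤_; _<_; z≤n; s≤s)
open import Data.Nat.Properties
  using (anyUpTo?; m≤m+n; m≤n+m; ≤-trans; ≤-reflexive; m≤n⇒m<n∨m≡n)
open import Data.Product.Base using (∃-syntax; ∃₂; _×_; _,_)
open import Data.Rational.Base as ℚ using (ℚ; _/_)
open import Data.Sum.Base using (inj₁; inj₂)
open import Relation.Binary.Definitions using (DecidableEquality)
open import Relation.Binary.PropositionalEquality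
  using (_≡_; _≢_; refl; sym; trans; cong; subst)
open import Relation.Nullary using (¬_; Dec; yes; no; contradiction)

private variable
  A : Set

Factor : List A → List A → Set
Factor = Infix _≡_

HasPeriod : List A → ℕ → Set
HasPeriod x p =
  1 ≤ p × p ≤ length x ×
  (∀ (i j : Fin (length x)) → toℕ j ≡ toℕ i + p → lookup x i ≡ lookup x j)

IsLeastPeriod : List A → ℕ → Set
IsLeastPeriod x p = HasPeriod x p × (∀ q → HasPeriod x q → p ≤ q)

-- The least period is written suc p so that the quotient is defined.
HasExponent : List A → ℚ → Set
HasExponent x e = ∃[ p ] IsLeastPeriod x (suc p) × e ≡ + length x / suc p

Free : ℚ → List A → Set
Free α x = ¬ (∃₂ λ f e → Factor f x × f ≢ [] × HasExponent f e × α ℚ.≤ e)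

IsOverlap : List A → Set
IsOverlap w = ∃₂ λ a x → w ≡ a ∷ x ++ a ∷ x ++ a ∷ []

OverlapFree : List A → Set
OverlapFree x = ¬ (∃[ f ] Factor f x × IsOverlap f)

infixr 8 _^_

_^_ : List A → ℕ → List A
z ^ k = concat (replicate k z)

EndsInPower : List A → ℕ → Set
EndsInPower u k = ∃₂ λ y z → z ≢ [] × u ≡ y ++ z ^ k

IsCurlingNumber : List A → ℕ → Set
IsCurlingNumber u k =
  1 ≤ k × EndsInPower u k × (∀ m → EndsInPower u m → m ≤ k)

module Greatest (P : ℕ → Set) (P? : ∀ k → Dec (P (suc k))) where

  -- The largest k with 1 ≤ k ≤ n and P k, or 0 if there is none.
  greatest : ℕ → ℕ
  greatest zero = zero
  greatest (suc n) with P? n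
  ... | yes _ = suc n
  ... | no  _ = greatest n

  greatest-upper : ∀ n m → m ≤ n → P m → m ≤ greatest n
  greatest-upper zero    m m≤n Pm = m≤n
  greatest-upper (suc n) m m≤n Pm with P? n
  ... | yes _ = m≤n
  ... | no ¬P with m≤n⇒m<n∨m≡n m≤n
  ...   | inj₁ (s≤s m≤n′) = greatest-upper n m m≤n′ Pm
  ...   | inj₂ refl       = contradiction Pm ¬P

  greatest-holds : ∀ n → 1 ≤ greatest n → P (greatest n)
  greatest-holds (suc n) 1≤ with P? n
  ... | yes p = p
  ... | no  _ = greatest-holds n 1≤

take-length-++ : (z w : List A) → take (length z) (z ++ w) ≡ z
take-length-++ []      w = refl
take-length-++ (a ∷ z) w = cong (a ∷_) (take-length-++ z w)

length-^ : (z : List A) → z ≢ [] → ∀ k → k ≤ length (z ^ k)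
length-^ z       z≢[] zero    = z≤n
length-^ []      z≢[] (suc k) = contradiction refl z≢[]
length-^ (a ∷ z) z≢[] (suc k) =
  s≤s (≤-trans (length-^ (a ∷ z) z≢[] k)
        (≤-trans (m≤n+m _ (length z)) (≤-reflexive (sym (length-++ z)))))

endsInPower-bound : (u : List A) → ∀ k → EndsInPower u k → k ≤ length u
endsInPower-bound u k (y , z , z≢[] , refl) =
  ≤-trans (length-^ z z≢[] k)
    (≤-trans (m≤n+m _ (length y)) (≤-reflexive (sym (length-++ y))))

module _ (_≟_ : DecidableEquality A) where

  isPower? : (u : List A) → ∀ k → Dec (∃[ z ] z ≢ [] × u ≡ z ^ suc k)
  isPower? [] k = no λ where
    ([]    , z≢[] , _) → z≢[] refl
    (_ ∷ _ , _    , ())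
  isPower? u@(_ ∷ _) k
    with anyUpTo? (λ p → ≡-dec _≟_ u (take (suc p) u ^ suc k)) (length u)
  ... | yes (p , _ , eq) = yes (take (suc p) u , (λ ()) , eq)
  ... | no ¬∃ = no λ where
    ([]    , z≢[] , _)  → z≢[] refl
    (a ∷ z , _    , eq) → ¬∃
      ( length z
      , subst (λ v → length z < length v) (sym eq)
          (s≤s (≤-trans (m≤m+n _ _) (≤-reflexive (sym (length-++ z)))))
      , trans eq (cong (_^ suc k) (sym (trans (cong (take (suc (length z))) eq)
          (take-length-++ (a ∷ z) ((a ∷ z) ^ k)))))
      )

  endsInPower? : (u : List A) → ∀ k → Dec (EndsInPower u (suc k))
  endsInPower? u k with isPower? u k
  ... | yes (z , z≢[] , eq) = yes ([] , z , z≢[] , eq)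
  endsInPower? [] k | no ¬pow = no λ where
    ([] , z , z≢[] , eq) → ¬pow (z , z≢[] , eq)
  endsInPower? (a ∷ u) k | no ¬pow with endsInPower? u k
  ... | yes (y , z , z≢[] , eq) = yes (a ∷ y , z , z≢[] , cong (a ∷_) eq)
  ... | no ¬ends = no λ where
    ([]    , z , z≢[] , eq)   → ¬pow (z , z≢[] , eq)
    (_ ∷ y , z , z≢[] , refl) → ¬ends (y , z , z≢[] , refl)

  -- Meaningful for nonempty words only; the value at [] is 0.
  curlingNumber : List A → ℕ
  curlingNumber u = Greatest.greatest (EndsInPower u) (endsInPower? u) (length u)

  curlingNumber-correct : ∀ u → u ≢ [] → IsCurlingNumber u (curlingNumber u)
  curlingNumber-correct []        u≢[] = contradiction refl u≢[]
  curlingNumber-correct u@(_ ∷ _) u≢[] =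
    1≤c , greatest-holds (length u) 1≤c , upper
    where
    open Greatest (EndsInPower u) (endsInPower? u)

    upper : ∀ m → EndsInPower u m → m ≤ curlingNumber u
    upper m ends =
      greatest-upper (length u) m (endsInPower-bound u m ends) ends

    1≤c : 1 ≤ curlingNumber u
    1≤c = upper 1 ([] , u , u≢[] , sym (++-identityʳ u))

  C : List A → List ℕ
  C x = tabulate λ (i : Fin (length x)) → curlingNumber (take (suc (toℕ i)) x)

{-# OPTIONS --safe #-}
module Submission where

-- Both conditions are inherited by prefixes, so the words can be enumerated by
-- a backtracking search. A 9/4-free word has no cubes, hence its curling
-- numbers are 1 and 2 according to whether the prefix ends in a square, and
-- after renaming letters it begins with 01 or 001. All repetitions at stake
-- have a period q + 1 and a length that is a function of q; whether a new
-- letter completes one is read off the last letters of the word.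

open import Defs
open import Data.Bool.Base using (Bool; true; false; if_then_else_; _∧_; _∨_)
open import Data.Fin.Base using (Fin; zero; suc; toℕ)
open import Data.Fin.Patterns using (0F; 1F; 2F)
open import Data.Fin.Properties using (_≟_; all?; toℕ-injective)
open import Data.Integer.Base using (+_)
import Data.Integer.Base as ℤ
import Data.Integer.Properties as ℤ
open import Data.List.Base
  using (List; []; _∷_; _++_; length; lookup; take; drop; map; reverse; tabulate; iterate; _ʳ++_)
open import Data.List.Membership.DecPropositional (_≟_ {3}) using (_∈?_)
open import Data.List.Membership.Propositional using (_∈_; _∉_)
open import Data.List.Properties
open import Data.List.Relation.Binary.Infix.Heterogeneous using (_++ⁱ_; _ⁱ++_; toView; MkView)
open import Data.List.Relation.Binary.Infix.Heterogeneous.Properties using (fromPointwise)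
import Data.List.Relation.Binary.Pointwise as Pointwise
open import Data.List.Relation.Unary.Any using (here; there)
open import Data.Nat.Base using (ℕ; zero; suc; _+_; _*_; _≤_; _<_; _>_; z≤n; s≤s; s≤s⁻¹)
open import Data.Nat.DivMod
  using (_%_; m/n*n≤m; m≡m%n+[m/n]*n; m%n<n; m*n/n≡m; /-monoˡ-≤) renaming (_/_ to _div_)
open import Data.Nat.Properties as ℕ hiding (_≟_)
open import Data.Nat.Tactic.RingSolver using (solve-∀)
open import Data.Product.Base using (∃-syntax; ∃₂; _×_; _,_; proj₁; proj₂)
open import Data.Rational.Base using (_/_)
import Data.Rational.Base as ℚ
import Data.Rational.Properties as ℚ
import Data.Rational.Unnormalised.Base as ℚᵘ
import Data.Rational.Unnormalised.Properties as ℚᵘ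
open import Data.Sum.Base using (_⊎_; inj₁; inj₂)
open import Function.Base using (_∘_; id)
open import Function.Bundles using (mk⇔)
open import Function.Definitions using (Injective)
open import Relation.Binary.Definitions using (DecidableEquality)
open import Relation.Binary.PropositionalEquality
open import Relation.Nullary using (¬_; Dec; yes; no; does; contradiction)
open import Relation.Nullary.Decidable
  using (_×-dec_; _→-dec_; map′; ¬?; from-yes; does-⇔)
open import Relation.Unary using (Decidable)

private variable
  A B : Set
  a b : A
  f s t u v w xs ys : List A
  j k p q : ℕ
  g : ℕ → ℕ

-- Common prefixes and words avoiding repetitions

data Agree {A : Set} : ℕ → List A → List A → Set where
  done : Agree 0 xs ys
  _∷_  : ∀ a → Agree k xs ys → Agree (suc k) (a ∷ xs) (a ∷ ys)

agree-++ : (m : List A) → Agree (length m) (m ++ xs) (m ++ ys)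
agree-++ []      = done
agree-++ (a ∷ m) = a ∷ agree-++ m

agree-split : Agree k xs ys →
  ∃[ m ] length m ≡ k × (∃[ v ] xs ≡ m ++ v) × (∃[ w ] ys ≡ m ++ w)
agree-split done = [] , refl , (_ , refl) , (_ , refl)
agree-split (a ∷ ag) with agree-split ag
... | m , refl , (v , refl) , (w , refl) =
  a ∷ m , refl , (v , refl) , (w , refl)

agree-weaken : j ≤ k → Agree k xs ys → Agree j xs ys
agree-weaken z≤n       _        = done
agree-weaken (s≤s j≤k) (a ∷ ag) = a ∷ agree-weaken j≤k ag

agree-length : Agree k xs ys → k ≤ length ys
agree-length done     = z≤n
agree-length (a ∷ ag) = s≤s (agree-length ag)

agree-map⁺ : (h : A → B) → Agree k xs ys → Agree k (map h xs) (map h ys)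
agree-map⁺ h done     = done
agree-map⁺ h (a ∷ ag) = h a ∷ agree-map⁺ h ag

agree-map⁻ : {h : A → B} → Injective _≡_ _≡_ h → ∀ k (xs ys : List A) →
  Agree k (map h xs) (map h ys) → Agree k xs ys
agree-map⁻ inj zero    xs       ys       ag = done
agree-map⁻ {h = h} inj (suc k) (x ∷ xs) (y ∷ ys) ag = go ag refl
  where
  -- The head `h y` is replaced by a variable `z`, so that matching on `_∷_` does not have to unify
  -- `h x` with `h y`; injectivity is applied afterwards.
  go : ∀ {z} → Agree (suc k) (h x ∷ map h xs) (z ∷ map h ys) → z ≡ h y →
    Agree (suc k) (x ∷ xs) (y ∷ ys)
  go (_ ∷ ag′) eq with inj eq
  ... | refl = x ∷ agree-map⁻ inj k xs ys ag′

-- Words are handled in reverse, last letter first. Prepending b to xs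
-- completes a suffix with period suc q and length suc q + suc (g q): a square
-- for g = id, an overlap for g = suc.
Completes : (ℕ → ℕ) → A → List A → Set
Completes g b xs = ∃[ q ] Agree (suc (g q)) (b ∷ xs) (drop q xs)

data Avoids {A : Set} (g : ℕ → ℕ) : List A → Set where
  []  : Avoids g []
  _∷_ : ¬ Completes g b xs → Avoids g xs → Avoids g (b ∷ xs)

completes-map⁺ : (h : A → B) → Completes g b xs → Completes g (h b) (map h xs)
completes-map⁺ {xs = xs} h (q , ag) =
  q , subst (Agree _ _) (sym (drop-map q xs)) (agree-map⁺ h ag)

completes-map⁻ : {h : A → B} → Injective _≡_ _≡_ h →
  Completes g (h b) (map h xs) → Completes g b xs
completes-map⁻ {b = b} {xs = xs} inj (q , ag) =
  q , agree-map⁻ inj _ (b ∷ xs) _ (subst (Agree _ _) (drop-map q xs) ag)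

avoids-map⁺ : {h : A → B} → Injective _≡_ _≡_ h → Avoids g xs → Avoids g (map h xs)
avoids-map⁺ inj []        = []
avoids-map⁺ inj (¬c ∷ av) = ¬c ∘ completes-map⁻ inj ∷ avoids-map⁺ inj av

avoids-map⁻ : (h : A → B) → ∀ xs → Avoids g (map h xs) → Avoids g xs
avoids-map⁻ h []       av        = []
avoids-map⁻ h (x ∷ xs) (¬c ∷ av) = ¬c ∘ completes-map⁺ h ∷ avoids-map⁻ h xs av

avoids-++⁻ : (u : List A) → Avoids g (u ++ xs) → Avoids g xs
avoids-++⁻ []      av       = av
avoids-++⁻ (_ ∷ u) (_ ∷ av) = avoids-++⁻ u av

avoids-ʳ++⁻ : (w : List A) → Avoids g (w ʳ++ xs) → Avoids g xs
avoids-ʳ++⁻ []      av = av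
avoids-ʳ++⁻ (_ ∷ w) av with avoids-ʳ++⁻ w av
... | _ ∷ av′ = av′

avoids-tabulate : (ys : List A) → (∀ u b v → ys ≡ u ++ b ∷ v → ¬ Completes g b v) →
  Avoids g ys
avoids-tabulate []       _ = []
avoids-tabulate (y ∷ ys) h =
  h [] y ys refl ∷ avoids-tabulate ys λ u b v eq → h (y ∷ u) b v (cong (y ∷_) eq)

-- Periods expressed as borders, a form stable under reversal

Border : ℕ → List A → Set
Border p s = ∃[ u ] ∃[ m ] ∃[ v ] length u ≡ p × s ≡ u ++ m × s ≡ m ++ v

-- Levi's lemma, with `u ++ v` cut no later than `s ++ t`.
++-split : ∀ (s u : List A) → s ++ t ≡ u ++ v → length u ≤ length s →
  ∃[ e ] s ≡ u ++ e × v ≡ e ++ t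
++-split s       []      eq u≤s       = s , refl , sym eq
++-split (x ∷ s) (y ∷ u) eq (s≤s u≤s) with ∷-injective eq
... | refl , eq′ with ++-split s u eq′ u≤s
...   | e , s≡ , v≡ = e , cong (x ∷_) s≡ , v≡

border-length : (b : Border p s) → length (proj₁ (proj₂ (proj₂ b))) ≡ p
border-length (u , m , v , refl , refl , eq) =
  +-cancelˡ-≡ (length m) _ _
    (trans (sym (length-++ m))
      (trans (cong length (sym eq)) (trans (length-++ u) (+-comm (length u) _))))

border-reverse : Border p s → Border p (reverse s)
border-reverse bd@(u , m , v , _ , s≡um , s≡mv) =
  reverse v , reverse m , reverse u ,
  trans (length-reverse v) (border-length bd) ,
  trans (cong reverse s≡mv) (reverse-++ m v) ,
  trans (cong reverse s≡um) (reverse-++ u m)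

drop-split : ∀ q (v : List A) → drop q v ≡ b ∷ w →
  ∃[ u ] length u ≡ q × v ≡ u ++ b ∷ w
drop-split zero    v       eq = [] , refl , eq
drop-split (suc q) (x ∷ v) eq with drop-split q v eq
... | u , u≡ , v≡ = x ∷ u , cong suc u≡ , cong (x ∷_) v≡

-- If `m` is the common prefix and `u` the `q` letters dropped from `v`, then `b ∷ v` starts both
-- with `(b ∷ u) ++ m` and with `m`. By length, `m` is a prefix of the former, hence a border of it.
completes⇒border : Completes g b v →
  ∃[ q ] ∃[ s ] ∃[ t ]
    b ∷ v ≡ s ++ t × length s ≡ suc q + suc (g q) × Border (suc q) s
completes⇒border {g = g} {b = b} {v = v} (q , ag) with agree-split ag
... | m@(c ∷ _) , m≡ , (x , bv≡) , (y , d≡) with drop-split q v d≡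
...   | u , refl , v≡
        with bv≡umy ← trans (cong (b ∷_) v≡) (sym (++-assoc (b ∷ u) m y))
        with |um| ← trans (length-++ (b ∷ u) {m}) (cong (_+_ (suc (length u))) m≡)
        with ++-split (b ∷ u ++ m) m (trans (sym bv≡umy) bv≡)
               (≤-trans (m≤n+m (length m) (suc (length u))) (≤-reflexive (sym (length-++ (b ∷ u)))))
...     | e , um≡me , _ =
  length u , b ∷ u ++ m , y , bv≡umy , |um| ,
  (b ∷ u , m , e , refl , refl , um≡me)

border⇒completes : Border (suc q) f → length f ≡ suc q + k → suc (g q) ≤ k →
  f ++ t ≡ b ∷ v → Completes g b v
border⇒completes {f = f} {k = k} {g = g} {t = t} (c ∷ u , m , w , refl , f≡um , f≡mw) |f| gq≤k eq
  with refl , refl ← ∷-injective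
         (trans (sym eq) (trans (cong (_++ t) f≡um) (++-assoc (c ∷ u) m t))) =
  length u ,
  subst₂ (Agree _) (trans (sym (++-assoc m w t)) (trans (cong (_++ t) (sym f≡mw)) eq))
    (sym (drop-length u))
    (agree-weaken (≤-trans gq≤k (≤-reflexive (sym |m|))) (agree-++ m))
  where
  |m| : length m ≡ k
  |m| = +-cancelˡ-≡ (suc (length u)) _ _
    (trans (sym (length-++ (c ∷ u))) (trans (cong length (sym f≡um)) |f|))

  drop-length : ∀ (u : List _) {r} → drop (length u) (u ++ r) ≡ r
  drop-length []      = refl
  drop-length (_ ∷ u) = drop-length u

-- Avoidance in a reversed word versus factors of the word

factor⇒++ : Factor f w → ∃₂ λ s t → w ≡ s ++ f ++ t
factor⇒++ fac with toView fac
... | MkView s f≡ t with Pointwise.Pointwise-≡⇒≡ f≡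
...   | refl = s , t , refl

++⇒factor : ∀ (s f t : List A) → Factor f (s ++ f ++ t)
++⇒factor s f t = s ++ⁱ (fromPointwise (Pointwise.refl refl) ⁱ++ t)

reverse-++-++ : ∀ (s f t : List A) →
  reverse (s ++ f ++ t) ≡ reverse t ++ reverse f ++ reverse s
reverse-++-++ s f t =
  trans (reverse-++ s (f ++ t))
    (trans (cong (_++ reverse s) (reverse-++ f t)) (++-assoc (reverse t) _ _))

factor-reverse : reverse w ≡ s ++ f ++ t → Factor (reverse f) w
factor-reverse {w = w} {s = s} {f = f} {t = t} eq = subst (Factor (reverse f))
  (trans (sym (reverse-++-++ s f t)) (trans (cong reverse (sym eq)) (reverse-involutive w)))
  (++⇒factor (reverse t) (reverse f) (reverse s))

-- Once `reverse t` is removed, the head of `reverse f` is the letter that completes the repetition.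
-- Repetitions longer than the minimal length `suc q + suc (g q)` are covered because agreement can
-- be shortened.
avoids⇒¬border : Avoids g (reverse w) → Factor f w →
  length f ≡ suc q + k → suc (g q) ≤ k → ¬ Border (suc q) f
avoids⇒¬border {w = w} {f = f} av fac |f| gq≤k bd with factor⇒++ fac
... | s , t , refl = go (reverse f) refl
  (avoids-++⁻ (reverse t) (subst (Avoids _) (reverse-++-++ s f t) av))
  where
  go : ∀ r → r ≡ reverse f → Avoids _ (r ++ reverse s) → _
  go []      eq _        = contradiction
    (trans (sym |f|) (trans (sym (length-reverse f)) (cong length (sym eq)))) λ()
  go (b ∷ r) eq (¬c ∷ _) = ¬c (border⇒completes
    (subst (Border _) (sym eq) (border-reverse bd))
    (trans (cong length eq) (trans (length-reverse f) |f|)) gq≤k refl)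

¬border⇒avoids :
  (∀ (f : List A) q → Factor f w → length f ≡ suc q + suc (g q) → ¬ Border (suc q) f) →
  Avoids g (reverse w)
¬border⇒avoids {w = w} h = avoids-tabulate (reverse w) λ u b v eq c →
  let q , s , t , bv≡ , |s| , bd = completes⇒border c in
  h (reverse s) q (factor-reverse {s = u} {f = s} (trans eq (cong (u ++_) bv≡)))
    (trans (length-reverse s) |s|) (border-reverse bd)

-- From indexed periods to borders and back

pointwise⇒prefix : (xs ys : List A) → length ys ≤ length xs →
  (∀ i j → toℕ i ≡ toℕ j → lookup xs i ≡ lookup ys j) → ∃[ v ] xs ≡ ys ++ v
pointwise⇒prefix xs       []       _         _ = xs , refl
pointwise⇒prefix (x ∷ xs) (y ∷ ys) (s≤s len) h
  with pointwise⇒prefix xs ys len (λ i j eq → h (suc i) (suc j) (cong suc eq))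
... | v , eq = v , cong₂ _∷_ (h zero zero refl) eq

lookup-drop : ∀ p (s : List A) j →
  ∃[ i ] toℕ i ≡ toℕ j + p × lookup s i ≡ lookup (drop p s) j
lookup-drop zero    s       j = j , sym (+-identityʳ _) , refl
lookup-drop (suc p) (_ ∷ s) j with lookup-drop p s j
... | i , i≡ , eq = suc i , trans (cong suc i≡) (sym (+-suc _ p)) , eq

lookup-shift : ∀ (u m v : List A) i j → toℕ j ≡ toℕ i + length u →
  lookup (m ++ v) i ≡ lookup (u ++ m) j
lookup-shift (_ ∷ u) m       v i       zero    eq =
  contradiction (trans eq (+-suc _ _)) λ()
lookup-shift (_ ∷ u) m       v i       (suc j) eq =
  lookup-shift u m v i j (suc-injective (trans eq (+-suc _ _)))
lookup-shift []      (_ ∷ m) v zero    zero    eq = refl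
lookup-shift []      (_ ∷ m) v (suc i) (suc j) eq =
  lookup-shift [] m v i j (suc-injective eq)

hasPeriod⇒border : HasPeriod s p → Border p s
hasPeriod⇒border {s = s} {p = p} (_ , p≤s , per)
  with pointwise⇒prefix s (drop p s)
         (≤-trans (≤-reflexive (length-drop p s)) (m∸n≤m _ p))
         (λ i j i≡j → let j′ , j′≡ , eq = lookup-drop p s j in
           trans (per i j′ (trans j′≡ (cong (_+ p) (sym i≡j)))) eq)
... | v , s≡ = take p s , drop p s , v ,
  trans (length-take p s) (m≤n⇒m⊓n≡m p≤s) , sym (take++drop≡id p s) , s≡

border⇒hasPeriod : 1 ≤ p → Border p s → HasPeriod s p
border⇒hasPeriod 1≤p (u , m , v , refl , s≡um , s≡mv) =
  1≤p ,
  ≤-trans (m≤m+n _ _) (≤-reflexive (sym (trans (cong length s≡um) (length-++ u)))) ,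
  λ i j → shift s≡mv s≡um i j
  where
  shift : ∀ {s s′} → s ≡ m ++ v → s′ ≡ u ++ m → ∀ i j → toℕ j ≡ toℕ i + length u →
    lookup s i ≡ lookup s′ j
  shift refl refl = lookup-shift u m v

hasPeriod? : DecidableEquality A → (s : List A) → Decidable (HasPeriod s)
hasPeriod? _≟ᴬ_ s p = 1 ≤? p ×-dec p ≤? length s ×-dec
  all? λ i → all? λ j → toℕ j ℕ.≟ toℕ i + p →-dec lookup s i ≟ᴬ lookup s j

least : {P : ℕ → Set} → Decidable P → ∀ n → P n →
  ∃[ m ] P m × (∀ k → P k → m ≤ k)
least P? zero    Pn = zero , Pn , λ _ _ → z≤n
least P? (suc n) Pn with P? zero
... | yes P0 = zero , P0 , λ _ _ → z≤n
... | no ¬P0 with least (P? ∘ suc) n Pn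
...   | m , Pm , min = suc m , Pm , λ where
  zero    P0 → contradiction P0 ¬P0
  (suc k) Pk → s≤s (min k Pk)

-- The exponent 9/4 as an inequality between natural numbers

9/4≤⇒ : ∀ n p → + 9 / 4 ℚ.≤ ℤ.+ n / suc p → 9 * suc p ≤ n * 4
-- `_/_` reduces to lowest terms, which is opaque for variable `n` and `p`. Over the unnormalised
-- rationals the order is cross-multiplication.
9/4≤⇒ n p le with ℚᵘ.≤-respʳ-≃ (ℚ.toℚᵘ-fromℚᵘ (ℚᵘ.mkℚᵘ (ℤ.+ n) p)) (ℚ.toℚᵘ-mono-≤ le)
... | ℚᵘ.*≤* le′ = ℤ.drop‿+≤+
  (subst₂ ℤ._≤_ (sym (ℤ.pos-* 9 (suc p))) (sym (ℤ.pos-* n 4)) le′)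

⇒9/4≤ : ∀ n p → 9 * suc p ≤ n * 4 → + 9 / 4 ℚ.≤ ℤ.+ n / suc p
⇒9/4≤ n p le = ℚ.toℚᵘ-cancel-≤
  (ℚᵘ.≤-respʳ-≃ (ℚᵘ.≃-sym (ℚ.toℚᵘ-fromℚᵘ (ℚᵘ.mkℚᵘ (ℤ.+ n) p)))
    (ℚᵘ.*≤* (subst₂ ℤ._≤_ (ℤ.pos-* 9 (suc p)) (ℤ.pos-* n 4) (ℤ.+≤+ le))))

-- suc q + suc (excess q) is the least n with 9/4 ≤ n / suc q.
excess : ℕ → ℕ
excess q = suc (q + q div 4)

-- After cancelling, this is `q ≤ 3 + q div 4 * 4`: the remainder modulo 4 is at most 3.
excess-long : ∀ q → 9 * suc q ≤ (suc q + suc (excess q)) * 4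
excess-long q = begin
  9 * suc q                          ≡⟨ split-off q ⟩
  8 * q + 9 + q                      ≡⟨ cong (_+_ (8 * q + 9)) (m≡m%n+[m/n]*n q 4) ⟩
  8 * q + 9 + (q % 4 + q div 4 * 4)  ≤⟨ +-monoʳ-≤ (8 * q + 9)
                                          (+-monoˡ-≤ (q div 4 * 4) (s≤s⁻¹ (m%n<n q 4))) ⟩
  8 * q + 9 + (3 + q div 4 * 4)      ≡⟨ rearrange q (q div 4) ⟩
  (suc q + suc (excess q)) * 4       ∎
  where
  open ≤-Reasoning

  split-off : ∀ q → 9 * suc q ≡ 8 * q + 9 + q
  split-off = solve-∀

  rearrange : ∀ q r → 8 * q + 9 + (3 + r * 4) ≡ (suc q + suc (suc (q + r))) * 4
  rearrange = solve-∀

long⇒excess : ∀ q k → 9 * suc q ≤ (suc q + k) * 4 → suc (excess q) ≤ k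
long⇒excess q k le = ≮⇒≥ λ k< → <⇒≱ (begin-strict
  (suc q + k) * 4           ≤⟨ *-monoˡ-≤ 4 (+-monoʳ-≤ (suc q) (s≤s⁻¹ k<)) ⟩
  (suc q + excess q) * 4    ≡⟨ rearrange₁ q (q div 4) ⟩
  8 * suc q + q div 4 * 4   ≤⟨ +-monoʳ-≤ (8 * suc q) (m/n*n≤m q 4) ⟩
  8 * suc q + q             <⟨ +-monoʳ-< (8 * suc q) (n<1+n q) ⟩
  8 * suc q + suc q         ≡⟨ rearrange₂ (suc q) ⟩
  9 * suc q                 ∎) le
  where
  open ≤-Reasoning

  rearrange₁ : ∀ q r → (suc q + suc (q + r)) * 4 ≡ 8 * suc q + r * 4
  rearrange₁ = solve-∀

  rearrange₂ : ∀ r → 8 * r + r ≡ 9 * r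
  rearrange₂ = solve-∀

border⇒nonempty : Border (suc q) s → s ≢ []
border⇒nonempty (_ ∷ _ , _ , _ , _ , refl , _) ()

-- The period `suc q` of a completed repetition may fail to be the least one. The least period is no
-- larger, so the exponent is still at least 9/4; decidability of equality serves to find it.
free⇒avoids : {w : List A} → DecidableEquality A → Free (+ 9 / 4) w → Avoids excess (reverse w)
free⇒avoids {w = w} _≟ᴬ_ free = ¬border⇒avoids λ f q fac |f| bd →
  let per = border⇒hasPeriod (s≤s z≤n) bd in
  go f q fac |f| (border⇒nonempty bd) (least (hasPeriod? _≟ᴬ_ f) (suc q) per) per
  where
  go : ∀ f q → Factor f w → length f ≡ suc q + suc (excess q) → f ≢ [] →
    (∃[ p ] IsLeastPeriod f p) → HasPeriod f (suc q) → _
  go f q fac |f| f≢[] (suc p , lp@(_ , min)) per =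
    free (f , _ , fac , f≢[] , (p , lp , refl) ,
      ⇒9/4≤ (length f) p (≤-trans (*-monoʳ-≤ 9 (min (suc q) per))
        (≤-trans (excess-long q) (≤-reflexive (cong (_* 4) (sym |f|))))))

avoids⇒free : Avoids excess (reverse w) → Free (+ 9 / 4) w
avoids⇒free av (f , _ , fac , _ , (p , (per , _) , refl) , le)
  with p≤f ← proj₁ (proj₂ per)
  with |f| ← sym (m+[n∸m]≡n p≤f) =
  avoids⇒¬border av fac |f|
    (long⇒excess p _ (subst (λ n → 9 * suc p ≤ n * 4) |f| (9/4≤⇒ (length f) p le)))
    (hasPeriod⇒border per)

-- Overlaps, squares and cubes

border-long : length s ≡ p + (p + j) → Border p s →
  ∃[ u ] ∃[ e ] ∃[ v ] length u ≡ p × length e ≡ j × s ≡ u ++ u ++ e × e ++ v ≡ u ++ e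
border-long {j = j} |s| (u , m , v , refl , refl , um≡mv)
  with |m| ← +-cancelˡ-≡ (length u) _ _ (trans (sym (length-++ u)) |s|)
  -- Since `u` is no longer than `m`, the equation `u ++ m ≡ m ++ v` makes it a prefix of `m`, which
  -- yields the second copy of `u`.
  with ++-split m u (sym um≡mv) (≤-trans (m≤m+n _ j) (≤-reflexive (sym |m|)))
... | e , refl , ue≡ev =
  u , e , v , refl , +-cancelˡ-≡ (length u) _ _ (trans (sym (length-++ u)) |m|) ,
  refl , sym ue≡ev

overlapFree⇒avoids : OverlapFree w → Avoids suc (reverse w)
overlapFree⇒avoids of = ¬border⇒avoids λ f q fac |f| bd →
  let ov = border-long (trans |f| (cong (_+_ (suc q)) (+-comm 1 (suc q)))) bd in
  of (f , fac , isOverlap ov)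
  where
  isOverlap : ∀ {f q} →
    ∃[ u ] ∃[ e ] ∃[ v ] length u ≡ suc q × length e ≡ 1 × f ≡ u ++ u ++ e × e ++ v ≡ u ++ e →
    IsOverlap f
  isOverlap (a ∷ x , b ∷ [] , v , _ , _ , refl , eq) with ∷-injectiveˡ eq
  ... | refl = a , x , refl

avoids⇒overlapFree : Avoids suc (reverse w) → OverlapFree w
avoids⇒overlapFree av (_ , fac , (a , x , refl)) =
  avoids⇒¬border av fac
    (cong suc (length-++ x))
    (≤-reflexive (cong suc (sym (trans (length-++ x) (+-comm (length x) 1)))))
    (a ∷ x , a ∷ x ++ a ∷ [] , x ++ a ∷ [] , refl , refl ,
      cong (a ∷_) (sym (++-assoc x (a ∷ []) (x ++ a ∷ []))))

completes⇒square : Completes id b ys → EndsInPower (reverse (b ∷ ys)) 2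
completes⇒square c with completes⇒border c
... | q , s , t , bys≡ , |s| , bd
  with border-long (trans |s| (cong (_+_ (suc q)) (sym (+-identityʳ _)))) bd
...   | u@(_ ∷ _) , [] , _ , _ , _ , refl , _ =
  reverse t , reverse u , reverse-≢[] u (λ ()) ,
  trans (cong reverse bys≡)
    (trans (reverse-++ (u ++ u ++ []) t) (cong (reverse t ++_)
      (trans (cong (reverse ∘ (u ++_)) (++-identityʳ u)) (trans (reverse-++ u u)
        (cong (reverse u ++_) (sym (++-identityʳ _)))))))
  where
  reverse-≢[] : ∀ (u : List _) → u ≢ [] → reverse u ≢ []
  reverse-≢[] u u≢[] eq = u≢[] (trans (sym (reverse-involutive u)) (cong reverse eq))

square⇒completes : EndsInPower (reverse (b ∷ ys)) 2 → Completes id b ys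
square⇒completes (y , []        , z≢[] , _) = contradiction refl z≢[]
square⇒completes {b = b} {ys = ys} (y , z@(c ∷ z′) , _ , eq) =
  border⇒completes {t = reverse y}
    (border-reverse {s = z ++ z} (z , z , z , refl , refl , refl))
    (trans (length-reverse (z ++ z)) (length-++ z)) ≤-refl
    (sym (trans (sym (reverse-involutive (b ∷ ys))) (trans (cong reverse eq)
      (trans (cong (λ r → reverse (y ++ z ++ r)) (++-identityʳ z)) (reverse-++ y (z ++ z))))))

-- Three copies of `z` have period `length z`. With `suc q` for that length they reach the forbidden
-- length, as `q div 4 ≤ q` gives `suc (excess q) ≤ suc q + suc q`.
avoids⇒¬cube : ∀ k → Avoids excess (reverse w) → ¬ EndsInPower w (3 + k)
avoids⇒¬cube k av (y , []       , z≢[] , _) = contradiction refl z≢[]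
avoids⇒¬cube {w = w} k av (y , z@(_ ∷ z′) , _ , eq) =
  avoids⇒¬border {f = z ++ z ++ z} av
    (subst (Factor _) (sym (trans eq (cong (y ++_) (assoc³ z (z ^ k)))))
      (++⇒factor y (z ++ z ++ z) (z ^ k)))
    (trans (length-++ z) (cong (_+_ (length z)) (length-++ z)))
    (s≤s (≤-trans
      (s≤s (+-monoʳ-≤ (length z′)
        (≤-trans (m≤m*n (length z′ div 4) 4) (m/n*n≤m (length z′) 4))))
      (≤-reflexive (sym (+-suc (length z′) (length z′))))))
    (z , z ++ z , z , refl , refl , sym (++-assoc z z z))
  where
  assoc³ : ∀ (z r : List _) → z ++ z ++ z ++ r ≡ (z ++ z ++ z) ++ r
  assoc³ z r = trans (cong (z ++_) (sym (++-assoc z z r))) (sym (++-assoc z (z ++ z) r))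

-- Curling numbers of words avoiding exponent 9/4

module _ (_≟ᴬ_ : DecidableEquality A) where

  isCurlingNumber-reverse : ∀ (b : A) ys →
    IsCurlingNumber (reverse (b ∷ ys)) (curlingNumber _≟ᴬ_ (reverse (b ∷ ys)))
  isCurlingNumber-reverse b ys = curlingNumber-correct _≟ᴬ_ (reverse (b ∷ ys)) λ eq →
    contradiction (trans (sym (reverse-involutive (b ∷ ys))) (cong reverse eq)) λ()

  -- The completed square forces at least 2, and the absence of cubes at most 2.
  curlingNumber≡2 : Avoids excess (b ∷ ys) → Completes id b ys →
    curlingNumber _≟ᴬ_ (reverse (b ∷ ys)) ≡ 2
  curlingNumber≡2 {b} {ys} av c
    with curlingNumber _≟ᴬ_ (reverse (b ∷ ys)) | isCurlingNumber-reverse b ys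
  ... | 0                | () , _
  ... | 1                | _ , _ , max = contradiction (max 2 (completes⇒square c)) λ { (s≤s ()) }
  ... | 2                | _ = refl
  ... | suc (suc (suc k)) | _ , ends , _ = contradiction ends
    (avoids⇒¬cube k (subst (Avoids _) (sym (reverse-involutive (b ∷ ys))) av))

  curlingNumber≡1 : Avoids excess (b ∷ ys) → ¬ Completes id b ys →
    curlingNumber _≟ᴬ_ (reverse (b ∷ ys)) ≡ 1
  curlingNumber≡1 {b} {ys} av ¬c
    with curlingNumber _≟ᴬ_ (reverse (b ∷ ys)) | isCurlingNumber-reverse b ys
  ... | 0                | () , _
  ... | 1                | _ = refl
  ... | 2                | _ , ends , _ = contradiction (square⇒completes ends) ¬c
  ... | suc (suc (suc k)) | _ , ends , _ = contradiction ends
    (avoids⇒¬cube k (subst (Avoids _) (sym (reverse-involutive (b ∷ ys))) av))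

module _ (f : List A → ℕ) where

  suffixValues : List A → List ℕ
  suffixValues []       = []
  suffixValues (b ∷ ys) = f (reverse (b ∷ ys)) ∷ suffixValues ys

  -- Prefixes of a word are suffixes of its reverse. The accumulator `ys` is the part already read,
  -- reversed; with `ys` empty and `f` the curling number, the left side is the reverse of `C`.
  prefixValues-ʳ++ : ∀ w ys →
    tabulate (λ (i : Fin (length w)) → f (reverse ys ++ take (suc (toℕ i)) w))
      ʳ++ suffixValues ys
      ≡ suffixValues (w ʳ++ ys)
  prefixValues-ʳ++ []      ys = refl
  prefixValues-ʳ++ (a ∷ w) ys = trans
    (cong₂ (λ c cs → cs ʳ++ c ∷ suffixValues ys)
      (cong f (sym (unfold-reverse a ys)))
      (tabulate-cong {n = length w} λ i → cong f (trans (sym (++-assoc (reverse ys) (a ∷ []) _))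
        (cong (_++ take (suc (toℕ i)) w) (sym (unfold-reverse a ys))))))
    (prefixValues-ʳ++ w (a ∷ ys))

-- Finding the letters that complete a repetition

Word : Set
Word = List (Fin 3)

-- Written by cases on the letters because the search spends its time here.
consIfAgree : ℕ → Word → Word → Fin 3 → Word → Word
consIfAgree zero    _         _         b r = b ∷ r
consIfAgree (suc k) (0F ∷ xs) (0F ∷ ys) b r = consIfAgree k xs ys b r
consIfAgree (suc k) (1F ∷ xs) (1F ∷ ys) b r = consIfAgree k xs ys b r
consIfAgree (suc k) (2F ∷ xs) (2F ∷ ys) b r = consIfAgree k xs ys b r
consIfAgree (suc k) _         _         b r = r

-- Entry `q` of the first list is the agreement required for period `suc q`, beyond the new letter
-- itself. That letter must equal the one at index `q` of the reversed word, so one pass collects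
-- all completing letters instead of testing each candidate.
completions : List ℕ → Word → Word → Word
completions []       xs _        = []
completions (k ∷ ks) xs []       = []
completions (k ∷ ks) xs (b ∷ ts) = consIfAgree k xs ts b (completions ks xs ts)

consIfAgree-cases : ∀ k xs ys b r →
  (Agree k xs ys × consIfAgree k xs ys b r ≡ b ∷ r) ⊎ consIfAgree k xs ys b r ≡ r
consIfAgree-cases zero    _         _         b r = inj₁ (done , refl)
consIfAgree-cases (suc k) (0F ∷ xs) (0F ∷ ys) b r with consIfAgree-cases k xs ys b r
... | inj₁ (ag , eq) = inj₁ (0F ∷ ag , eq)
... | inj₂ eq        = inj₂ eq
consIfAgree-cases (suc k) (1F ∷ xs) (1F ∷ ys) b r with consIfAgree-cases k xs ys b r
... | inj₁ (ag , eq) = inj₁ (1F ∷ ag , eq)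
... | inj₂ eq        = inj₂ eq
consIfAgree-cases (suc k) (2F ∷ xs) (2F ∷ ys) b r with consIfAgree-cases k xs ys b r
... | inj₁ (ag , eq) = inj₁ (2F ∷ ag , eq)
... | inj₂ eq        = inj₂ eq
consIfAgree-cases (suc k) []        _         b r = inj₂ refl
consIfAgree-cases (suc k) (0F ∷ xs) []        b r = inj₂ refl
consIfAgree-cases (suc k) (1F ∷ xs) []        b r = inj₂ refl
consIfAgree-cases (suc k) (2F ∷ xs) []        b r = inj₂ refl
consIfAgree-cases (suc k) (0F ∷ xs) (1F ∷ ys) b r = inj₂ refl
consIfAgree-cases (suc k) (0F ∷ xs) (2F ∷ ys) b r = inj₂ refl
consIfAgree-cases (suc k) (1F ∷ xs) (0F ∷ ys) b r = inj₂ refl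
consIfAgree-cases (suc k) (1F ∷ xs) (2F ∷ ys) b r = inj₂ refl
consIfAgree-cases (suc k) (2F ∷ xs) (0F ∷ ys) b r = inj₂ refl
consIfAgree-cases (suc k) (2F ∷ xs) (1F ∷ ys) b r = inj₂ refl

consIfAgree-agree : ∀ {k xs ys} b r → Agree k xs ys → consIfAgree k xs ys b r ≡ b ∷ r
consIfAgree-agree b r done      = refl
consIfAgree-agree b r (0F ∷ ag) = consIfAgree-agree b r ag
consIfAgree-agree b r (1F ∷ ag) = consIfAgree-agree b r ag
consIfAgree-agree b r (2F ∷ ag) = consIfAgree-agree b r ag

drop-suc : ∀ {A : Set} q {xs ts : List A} {b} → drop q xs ≡ b ∷ ts → drop (suc q) xs ≡ ts
drop-suc zero    {_ ∷ _} refl = refl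
drop-suc (suc q) {_ ∷ _} eq   = drop-suc q eq

completions-sound : ∀ g n q {xs} ts → drop q xs ≡ ts →
  a ∈ completions (map g (iterate suc q n)) xs ts → Completes g a xs
completions-sound g (suc n) q {xs} (b ∷ ts) eq a∈
  with consIfAgree-cases (g q) xs ts b (completions (map g (iterate suc (suc q) n)) xs ts)
... | inj₂ r rewrite r = completions-sound g n (suc q) ts (drop-suc q eq) a∈
... | inj₁ (ag , r) rewrite r with a∈
...   | here refl = q , subst (Agree _ _) (sym eq) (b ∷ ag)
...   | there a∈′ = completions-sound g n (suc q) ts (drop-suc q eq) a∈′

-- Needed where a negative answer counts: in `square?`, since a missed square would give a wrong
-- curling number, and in `completes?`, which certifies the word of length 84.
completions-complete : ∀ g n q i {xs} ts → i < n →
  Agree (suc (g (q + i))) (a ∷ xs) (drop i ts) →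
  a ∈ completions (map g (iterate suc q n)) xs ts
completions-complete g (suc n) q zero {xs} (b ∷ ts) _ (_ ∷ ag)
  rewrite consIfAgree-agree b (completions (map g (iterate suc (suc q) n)) xs ts)
            (subst (λ q → Agree (g q) xs ts) (+-identityʳ q) ag) = here refl
completions-complete {a = a} g (suc n) q (suc i) {xs} (b ∷ ts) (s≤s i<n) ag
  with a∈ ← completions-complete g n (suc q) i ts i<n
              (subst (λ q → Agree (suc (g q)) (a ∷ xs) (drop i ts)) (+-suc q i) ag)
  with consIfAgree-cases (g q) xs ts b (completions (map g (iterate suc (suc q) n)) xs ts)
... | inj₂ r       rewrite r = a∈
... | inj₁ (_ , r) rewrite r = there a∈

agree-drop-length : ∀ {k q} {xs ys : Word} → Agree (suc k) xs (drop q ys) → suc k + q ≤ length ys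
agree-drop-length {k} {q} {ys = ys} ag =
  ≤-trans (+-monoˡ-≤ q (≤-trans (agree-length ag) (≤-reflexive (length-drop q ys))))
    (≤-reflexive (m∸n+n≡m (<⇒≤ (q< ag))))
  where
  q< : Agree (suc k) _ (drop q ys) → q < length ys
  q< ag = ≰⇒> λ len≤ → contradiction
    (≤-trans (agree-length ag) (≤-reflexive (cong length (drop-all q ys len≤)))) λ()

-- An agreement of at least one letter forces `q < length xs`, so `length xs` periods exhaust all
-- cases.
completes? : ∀ g b xs → Dec (Completes g b xs)
completes? g b xs = map′ (completions-sound g (length xs) 0 xs refl)
  (λ (q , ag) → completions-complete g (length xs) 0 q xs
    (≤-trans (s≤s (m≤n+m q _)) (agree-drop-length ag)) ag)
  (b ∈? completions (map g (iterate suc 0 (length xs))) xs xs)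

avoids? : ∀ g xs → Dec (Avoids g xs)
avoids? g []       = yes []
avoids? g (b ∷ xs) = map′ (λ (¬c , av) → ¬c ∷ av) (λ { (¬c ∷ av) → ¬c , av })
  (¬? (completes? g b xs) ×-dec avoids? g xs)

-- Deciding squares and computing curling letters

squareRuns : ℕ → List ℕ
squareRuns n = iterate suc 0 (n div 2)

-- `map′` keeps the Boolean of the membership test, so `curl b xs` unfolds to the very expression
-- that the search evaluates.
square? : ∀ b xs → Dec (Completes id b xs)
square? b xs = map′
  (completions-sound id n 0 xs refl ∘ subst (λ ks → b ∈ completions ks xs xs) (sym runs≡))
  (λ (q , ag) → subst (λ ks → b ∈ completions ks xs xs) runs≡
    (completions-complete id n 0 q xs (half q (agree-drop-length ag)) ag))
  (b ∈? completions (squareRuns (suc (length xs))) xs xs)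
  where
  n = suc (length xs) div 2

  runs≡ : map id (iterate suc 0 n) ≡ iterate suc 0 n
  runs≡ = map-id (iterate suc 0 n)

  -- A square of period `suc q` fills `2 * suc q` of the `suc (length xs)` letters present once the
  -- new one is added.
  half : ∀ q → suc q + q ≤ length xs → q < suc (length xs) div 2
  half q le = ≤-trans (≤-reflexive (sym (m*n/n≡m (suc q) 2))) (/-monoˡ-≤ 2 (s≤s (≤-trans
    (≤-reflexive (cong suc (trans (*-comm q 2) (cong (_+_ q) (+-identityʳ q))))) le)))

-- The letters 1F and 2F stand for the curling numbers 1 and 2.
curlLetter : Bool → Fin 3
curlLetter s = if s then 2F else 1F

curl : Fin 3 → Word → Fin 3
curl b xs = curlLetter (does (square? b xs))

curls : Word → Word
curls []       = []
curls (b ∷ xs) = curl b xs ∷ curls xs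

curls-map : {h : Fin 3 → Fin 3} → Injective _≡_ _≡_ h → ∀ xs → curls (map h xs) ≡ curls xs
curls-map         inj []       = refl
curls-map {h = h} inj (b ∷ xs) = cong₂ _∷_
  (cong curlLetter (does-⇔ (mk⇔ (completes-map⁻ inj) (completes-map⁺ h))
    (square? (h b) (map h xs)) (square? b xs)))
  (curls-map inj xs)

suffixValues-curlingNumber : ∀ xs → Avoids excess xs →
  suffixValues (curlingNumber _≟_) xs ≡ map toℕ (curls xs)
suffixValues-curlingNumber []       _  = refl
suffixValues-curlingNumber (b ∷ xs) av@(_ ∷ av′) =
  cong₂ _∷_ (value (square? b xs)) (suffixValues-curlingNumber xs av′)
  where
  value : (s : Dec (Completes id b xs)) →
    curlingNumber _≟_ (reverse (b ∷ xs)) ≡ toℕ (curlLetter (does s))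
  value (yes c) = curlingNumber≡2 _≟_ av c
  value (no ¬c) = curlingNumber≡1 _≟_ av ¬c

reverse-C : ∀ x → Avoids excess (reverse x) → reverse (C _≟_ x) ≡ map toℕ (curls (reverse x))
reverse-C x av = trans (prefixValues-ʳ++ (curlingNumber _≟_) x [])
  (suffixValues-curlingNumber (reverse x) av)

-- The backtracking search and its soundness

-- xs is a reversed word of length d and cs the reversed word of its curling
-- numbers; true means that xs has no admissible extension by n letters. The
-- bounds 24 and 12 on the periods tested only affect how much is pruned, whereas
-- the test for squares has to be complete.
mutual
  search : ℕ → ℕ → Word → Word → Bool
  search zero    d xs cs = false
  search (suc n) d xs cs = fork n (suc d) xs cs
    (completions (iterate suc 1 24) cs cs)
    (completions (squareRuns (suc d)) xs xs)
    (completions (map excess (iterate suc 0 12)) xs xs)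

  fork : ℕ → ℕ → Word → Word → Word → Word → Word → Bool
  -- If both 1 and 2 would complete an overlap of curling numbers, no letter can follow, and the
  -- branch is cut before squares or letters are examined.
  fork n d xs cs os ss es = (does (1F ∈? os) ∧ does (2F ∈? os)) ∨
    (grow n d xs cs os es 0F (curlLetter (does (0F ∈? ss))) ∧
     grow n d xs cs os es 1F (curlLetter (does (1F ∈? ss))) ∧
     grow n d xs cs os es 2F (curlLetter (does (2F ∈? ss))))

  grow : ℕ → ℕ → Word → Word → Word → Word → Fin 3 → Fin 3 → Bool
  grow n d xs cs os es a c =
    does (c ∈? os) ∨ does (a ∈? es) ∨ search n d (a ∷ xs) (c ∷ cs)

curls-ʳ++⁻ : ∀ {g} w {xs} → Avoids g (curls (w ʳ++ xs)) → Avoids g (curls xs)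
curls-ʳ++⁻ []      av = av
curls-ʳ++⁻ (_ ∷ w) av with curls-ʳ++⁻ w av
... | _ ∷ av′ = av′

does⇒ : {P : Set} (P? : Dec P) → does P? ≡ true → P
does⇒ (yes p) _ = p

∧-split : ∀ x {y} → x ∧ y ≡ true → x ≡ true × y ≡ true
∧-split true eq = refl , eq

∨-split : ∀ x {y} → x ∨ y ≡ true → x ≡ true ⊎ y ≡ true
∨-split true  eq = inj₁ refl
∨-split false eq = inj₂ eq

dead : ℕ → Word → Bool
dead n xs = search n (length xs) xs (curls xs)

-- Induction on `n`, following the branch of the first letter of `w`. The arguments of the recursive
-- call to `search` are by computation the length and the `curls` of `a ∷ xs`, so the call is again
-- an instance of `dead`. A search with `n` equal to 0 returns `false`, which rules out the base
-- case.
dead-sound : ∀ n xs → dead n xs ≡ true →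
  ∀ w → n ≤ length w → Avoids excess (w ʳ++ xs) → ¬ Avoids suc (curls (w ʳ++ xs))
dead-sound (suc n) xs dead (a ∷ w) (s≤s n≤) avˣ avᶜ = fork-sound (∨-split _ dead)
  where
  os = completions (iterate suc 1 24) (curls xs) (curls xs)
  ss = completions (squareRuns (suc (length xs))) xs xs
  es = completions (map excess (iterate suc 0 12)) xs xs

  c∉os : curl a xs ∉ os
  c∉os c∈ with curls-ʳ++⁻ w avᶜ
  ... | ¬c ∷ _ = ¬c (completions-sound suc 24 0 (curls xs) refl c∈)

  a∉es : a ∉ es
  a∉es a∈ with avoids-ʳ++⁻ w avˣ
  ... | ¬a ∷ _ = ¬a (completions-sound excess 12 0 xs refl a∈)

  curlLetter∈ : ∀ s → 1F ∈ os → 2F ∈ os → curlLetter s ∈ os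
  curlLetter∈ true  1∈ 2∈ = 2∈
  curlLetter∈ false 1∈ 2∈ = 1∈

  grow-sound : ¬ grow n (suc (length xs)) xs (curls xs) os es a (curl a xs) ≡ true
  grow-sound eq with ∨-split (does (curl a xs ∈? os)) eq
  ... | inj₁ c∈ = c∉os (does⇒ (curl a xs ∈? os) c∈)
  ... | inj₂ eq′ with ∨-split (does (a ∈? es)) eq′
  ...   | inj₁ a∈   = a∉es (does⇒ (a ∈? es) a∈)
  ...   | inj₂ dead = dead-sound n (a ∷ xs) dead w n≤ avˣ avᶜ

  growth : Fin 3 → Bool
  growth b = grow n (suc (length xs)) xs (curls xs) os es b (curlLetter (does (b ∈? ss)))

  choose : growth 0F ∧ growth 1F ∧ growth 2F ≡ true → ∀ b → growth b ≡ true
  choose eq b with ∧-split (growth 0F) eq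
  ... | eq₀ , eq₁₂ with ∧-split (growth 1F) eq₁₂
  choose eq 0F | eq₀ , _ | _ , _     = eq₀
  choose eq 1F | _ , _   | eq₁ , _   = eq₁
  choose eq 2F | _ , _   | _ , eq₂   = eq₂

  fork-sound : does (1F ∈? os) ∧ does (2F ∈? os) ≡ true ⊎
    growth 0F ∧ growth 1F ∧ growth 2F ≡ true → _
  fork-sound (inj₁ eq) with ∧-split (does (1F ∈? os)) eq
  ... | eq₁ , eq₂ = c∉os (curlLetter∈ _ (does⇒ (1F ∈? os) eq₁) (does⇒ (2F ∈? os) eq₂))
  fork-sound (inj₂ eq) = grow-sound (choose eq a)

-- Normal forms up to renaming, the witness and the conclusion

Good : Word → Set
Good x = Avoids excess (reverse x) × Avoids suc (curls (reverse x))

good-map : {h : Fin 3 → Fin 3} → Injective _≡_ _≡_ h → ∀ x → Good x → Good (map h x)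
good-map {h} inj x (avˣ , avᶜ) =
  subst (Avoids excess) (reverse-map h x) (avoids-map⁺ inj avˣ) ,
  subst (Avoids suc)
    (trans (sym (curls-map inj (reverse x))) (cong curls (reverse-map h x))) avᶜ

relabel : Fin 3 → Fin 3 → Fin 3 → Fin 3
relabel a b c = if does (c ≟ a) then 0F else if does (c ≟ b) then 1F else 2F

relabel-properties : ∀ a b → a ≢ b →
  relabel a b a ≡ 0F × relabel a b b ≡ 1F ×
  (∀ c d → relabel a b c ≡ relabel a b d → c ≡ d)
relabel-properties = from-yes (all? λ a → all? λ b → ¬? (a ≟ b) →-dec
  (relabel a b a ≟ 0F ×-dec relabel a b b ≟ 1F ×-dec
   all? λ c → all? λ d → relabel a b c ≟ relabel a b d →-dec c ≟ d))

-- The search is run by the type checker. The depths 83 here and 82 for the other prefix both lead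
-- to total length 85.
dead-01 : dead 83 (1F ∷ 0F ∷ []) ≡ true
dead-01 = refl

dead-001 : dead 82 (1F ∷ 0F ∷ 0F ∷ []) ≡ true
dead-001 = refl

good-01-short : ∀ w → 83 ≤ length w → ¬ Good (0F ∷ 1F ∷ w)
good-01-short w le (avˣ , avᶜ) = dead-sound 83 (1F ∷ 0F ∷ []) dead-01 w le avˣ avᶜ

good-001-short : ∀ w → 82 ≤ length w → ¬ Good (0F ∷ 0F ∷ 1F ∷ w)
good-001-short w le (avˣ , avᶜ) = dead-sound 82 (1F ∷ 0F ∷ 0F ∷ []) dead-001 w le avˣ avᶜ

-- The first letter different from `a` is renamed to 1 and `a` to 0. If it is `b`, the word starts
-- with 01; if it is `c`, with 001; otherwise the word starts with a cube of one letter.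
good⇒short : ∀ x → Good x → ¬ length x > 84
good⇒short (a ∷ b ∷ c ∷ w) good@(avˣ , _) (s≤s (s≤s (s≤s 82≤w))) with a ≟ b | a ≟ c
... | no a≢b | _ =
  let h = relabel a b ; ha , hb , inj = relabel-properties a b a≢b in
  good-01-short (map h (c ∷ w)) (s≤s (≤-trans 82≤w (≤-reflexive (sym (length-map h w)))))
    (subst₂ (λ y z → Good (y ∷ z ∷ map h (c ∷ w))) ha hb
      (good-map (inj _ _) (a ∷ b ∷ c ∷ w) good))
... | yes refl | no a≢c =
  let h = relabel a c ; ha , hc , inj = relabel-properties a c a≢c in
  good-001-short (map h w) (≤-trans 82≤w (≤-reflexive (sym (length-map h w))))
    (subst₂ (λ y z → Good (y ∷ y ∷ z ∷ map h w)) ha hc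
      (good-map (inj _ _) (a ∷ a ∷ c ∷ w) good))
... | yes refl | yes refl with avoids-ʳ++⁻ w avˣ
...   | ¬aaa ∷ _ = ¬aaa (0 , a ∷ a ∷ done)

longest : Word
longest =
  0F ∷ 1F ∷ 1F ∷ 0F ∷ 1F ∷ 0F ∷ 0F ∷ 1F ∷ 0F ∷ 2F ∷ 0F ∷ 0F ∷ 2F ∷ 0F ∷
  2F ∷ 1F ∷ 2F ∷ 1F ∷ 1F ∷ 0F ∷ 0F ∷ 2F ∷ 0F ∷ 0F ∷ 2F ∷ 1F ∷ 0F ∷ 0F ∷
  2F ∷ 1F ∷ 1F ∷ 0F ∷ 1F ∷ 0F ∷ 0F ∷ 1F ∷ 0F ∷ 2F ∷ 0F ∷ 0F ∷ 2F ∷ 0F ∷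
  2F ∷ 1F ∷ 1F ∷ 0F ∷ 1F ∷ 1F ∷ 0F ∷ 2F ∷ 0F ∷ 0F ∷ 2F ∷ 0F ∷ 2F ∷ 1F ∷
  2F ∷ 1F ∷ 1F ∷ 0F ∷ 0F ∷ 2F ∷ 0F ∷ 0F ∷ 2F ∷ 1F ∷ 0F ∷ 0F ∷ 2F ∷ 1F ∷
  1F ∷ 2F ∷ 2F ∷ 0F ∷ 1F ∷ 1F ∷ 2F ∷ 2F ∷ 0F ∷ 2F ∷ 1F ∷ 1F ∷ 0F ∷ 0F ∷ []

longest-good : Good longest
-- Unlike the search, these tests cover every period.
longest-good = from-yes (avoids? excess (reverse longest)) ,
  from-yes (avoids? suc (curls (reverse longest)))

good⇒ : ∀ x → Good x → Free (+ 9 / 4) x × OverlapFree (C _≟_ x)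
good⇒ x (avˣ , avᶜ) = avoids⇒free avˣ ,
  avoids⇒overlapFree (subst (Avoids suc) (sym (reverse-C x avˣ)) (avoids-map⁺ toℕ-injective avᶜ))

⇒good : ∀ x → Free (+ 9 / 4) x → OverlapFree (C _≟_ x) → Good x
⇒good x free of = avˣ ,
  -- Avoidance in `x` comes first: only then do the letters of `C` agree with `curls`.
  avoids-map⁻ toℕ _ (subst (Avoids suc) (reverse-C x avˣ) (overlapFree⇒avoids of))
  where
  avˣ = free⇒avoids _≟_ free

theorem9 : (∃[ x ] Free {Fin 3} (+ 9 / 4) x × OverlapFree (C _≟_ x) × length x ≡ 84) ×
    ¬ (∃[ x ] Free {Fin 3} (+ 9 / 4) x × OverlapFree (C _≟_ x) × length x > 84)
theorem9 =
  (longest , proj₁ (good⇒ longest longest-good) , proj₂ (good⇒ longest longest-good) , refl) ,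
  λ (x , free , of , long) → good⇒short x (⇒good x free of) long
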